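{- Let $\mathbf{r}=(r_0,r_1)\in\mathbb{R}^2$. The mapping $\tau_{\mathbf{r}}$ has a nontrivial cycle whose elements all have the same sign if and only if $-2<r_0+r_1<0$. Thus, the set $\{(r_0,r_1)\in\mathbb{R}^2 : -2<r_0+r_1<0\}$ has empty intersection with $\mathcal{D}_2^{(*)}$. In particular, if $-1\le r_0+r_1<0$, then $(1)$ is a cycle of $\tau_{\mathbf{r}}$, and if $-2<r_0+r_1<-1$, then $(-1)$ is a cycle of $\tau_{\mathbf{r}}$.
   Context: For $\mathbf{r}=(r_0,r_1)\in\mathbb{R}^2$, the two-dimensional shift radix system is the map $\tau_{\mathbf{r}}:\mathbb{Z}^2\to\mathbb{Z}^2$, $\tau_{\mathbf{r}}(a_0,a_1)=(a_1,-\lfloor r_0a_0+r_1a_1\rfloor)$. The orbit of $(a_0,a_1)$ is identified with the integer sequence $(a_n)_{n\ge 0}$ where $a_{n+2}=-\lfloor r_0a_n+r_1a_{n+1}\rfloor$ for $n\ge0$. An orbit is ultimately periodic if there are $n_0\ge 0$, $p>0$ with $a_{n+p}=a_n$ for all $n\ge n_0$; in this case $(a_n,\ldots,a_{n+p-1})$ with $n\ge n_0$ is called a cycle of $\tau_{\mathbf{r}}$. The cycle $(0)$ is trivial, all other cycles are nontrivial. "All have the same sign" means all elements are strictly positive or all are strictly negative. $\mathcal{D}_2^{(*)}$ is the set of all $\mathbf{r}\in\mathbb{R}^2$ such that each ultimately periodic orbit of $\tau_{\mathbf{r}}$ ends up in the trivial cycle, i.e. satisfies $a_n=0$ for all sufficiently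 large $n$. -}

module Defs where

open import Axiom.ExcludedMiddle using (ExcludedMiddle)
open import Data.Integer as ℤ using (ℤ; +_; 0ℤ; 1ℤ; -1ℤ)
import Data.Integer.DivMod as ℤ
import Data.Integer.Properties as ℤ
open import Data.List.Base using (List; applyUpTo)
open import Data.List.Relation.Unary.All using (All)
open import Data.Nat as ℕ using (ℕ)
open import Data.Nat.GeneralisedArithmetic using (fold)
import Data.Nat.Properties as ℕ
open import Data.Product using (∃-syntax; _×_; _,_; proj₁; proj₂)
open import Data.Rational as ℚ using (ℚ; 0ℚ; 1ℚ; mkℚ)
import Data.Rational.Properties as ℚ
import Data.Rational.Unnormalised as ℚᵘ
import Data.Rational.Unnormalised.Properties as ℚᵘ
open import Data.Rational.Solver using (module +-*-Solver)
open import Data.Sum using (_⊎_; inj₁; inj₂)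
open import Level using (0ℓ)
open import Relation.Binary.PropositionalEquality
open import Relation.Nullary using (¬_; Dec; yes; no)
open import Relation.Unary using (Pred)

ℤ→ℚ : ℤ → ℚ
ℤ→ℚ i = i ℚ./ 1

toℚᵘ-ℤ→ℚ : ∀ i → ℚ.toℚᵘ (ℤ→ℚ i) ℚᵘ.≃ (i ℚᵘ./ 1)
toℚᵘ-ℤ→ℚ i = ℚ.toℚᵘ-fromℚᵘ (i ℚᵘ./ 1)

ℤ→ℚ-+ : ∀ i j → ℤ→ℚ (i ℤ.+ j) ≡ ℤ→ℚ i ℚ.+ ℤ→ℚ j
ℤ→ℚ-+ i j = ℚ.toℚᵘ-injective (begin
  ℚ.toℚᵘ (ℤ→ℚ (i ℤ.+ j))                   ≈⟨ toℚᵘ-ℤ→ℚ (i ℤ.+ j) ⟩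
  (i ℤ.+ j) ℚᵘ./ 1                         ≈⟨ ℚᵘ.*≡* (cong (ℤ._* 1ℤ) (sym (cong₂ ℤ._+_ (ℤ.*-identityʳ i) (ℤ.*-identityʳ j)))) ⟩
  (i ℚᵘ./ 1) ℚᵘ.+ (j ℚᵘ./ 1)               ≈⟨ ℚᵘ.+-cong (toℚᵘ-ℤ→ℚ i) (toℚᵘ-ℤ→ℚ j) ⟨
  ℚ.toℚᵘ (ℤ→ℚ i) ℚᵘ.+ ℚ.toℚᵘ (ℤ→ℚ j)       ≈⟨ ℚ.toℚᵘ-homo-+ (ℤ→ℚ i) (ℤ→ℚ j) ⟨
  ℚ.toℚᵘ (ℤ→ℚ i ℚ.+ ℤ→ℚ j)                 ∎)
  where open ℚᵘ.≃-Reasoning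

floor-≤ : ∀ q → ℤ→ℚ (ℚ.floor q) ℚ.≤ q
floor-≤ q@(mkℚ n d-1 _) = ℚ.toℚᵘ-cancel-≤
  (ℚᵘ.≤-respˡ-≃ (ℚᵘ.≃-sym (toℚᵘ-ℤ→ℚ (ℚ.floor q)))
    (ℚᵘ.*≤* (subst₂ ℤ._≤_ (cong (ℤ._* (+ ℕ.suc d-1)) (sym (ℤ.div-pos-is-/ℕ n (ℕ.suc d-1))))
                          (sym (ℤ.*-identityʳ n))
                          (ℤ.[n/ℕd]*d≤n n (ℕ.suc d-1)))))

<-floor+1 : ∀ q → q ℚ.< ℤ→ℚ (ℚ.floor q) ℚ.+ 1ℚ
<-floor+1 q@(mkℚ n d-1 _) = subst (q ℚ.<_) (ℤ→ℚ-+ (ℚ.floor q) 1ℤ) (ℚ.toℚᵘ-cancel-<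
  (ℚᵘ.<-respʳ-≃ (ℚᵘ.≃-sym (toℚᵘ-ℤ→ℚ (ℚ.floor q ℤ.+ 1ℤ)))
    (ℚᵘ.*<* (subst₂ ℤ._<_ (sym (ℤ.*-identityʳ n))
       (cong (ℤ._* (+ ℕ.suc d-1))
         (trans (ℤ.+-comm 1ℤ (n ℤ./ℕ ℕ.suc d-1)) (cong (ℤ._+ 1ℤ) (sym (ℤ.div-pos-is-/ℕ n (ℕ.suc d-1))))))
       (ℤ.n<s[n/ℕd]*d n (ℕ.suc d-1))))))

Cauchy : Pred (ℕ → ℚ) 0ℓ
Cauchy x = ∀ ε → 0ℚ ℚ.< ε →
  ∃[ N ] ∀ m n → N ℕ.≤ m → N ℕ.≤ n → ℚ.∣ x m ℚ.- x n ∣ ℚ.< ε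

record ℝ : Set where
  constructor mkℝ
  field
    seq    : ℕ → ℚ
    cauchy : Cauchy seq

open ℝ public

ℚ→ℝ : ℚ → ℝ
ℚ→ℝ q = mkℝ (λ _ → q) λ ε ε>0 → 0 , λ _ _ _ _ →
  subst (ℚ._< ε) (sym (cong ℚ.∣_∣ (ℚ.+-inverseʳ q))) ε>0

fromℤ : ℤ → ℝ
fromℤ i = ℚ→ℝ (ℤ→ℚ i)

infix 4 _<_ _≤_ _≈_

_<_ : ℝ → ℝ → Set
x < y = ∃[ ε ] 0ℚ ℚ.< ε × ∃[ N ] ∀ n → N ℕ.≤ n → seq x n ℚ.+ ε ℚ.≤ seq y n

_≤_ : ℝ → ℝ → Set
x ≤ y = ¬ (y < x)

-- A real number has many representing sequences; equality of reals is _≈_,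
-- not _≡_.
_≈_ : ℝ → ℝ → Set
x ≈ y = x ≤ y × y ≤ x

private
  half : ∀ ε → 0ℚ ℚ.< ε → 0ℚ ℚ.< ε ℚ.* ℚ.½
  half ε ε>0 = subst (ℚ._< ε ℚ.* ℚ.½) (ℚ.*-zeroˡ ℚ.½) (ℚ.*-monoˡ-<-pos ℚ.½ ε>0)

  half+half : ∀ ε → ε ℚ.* ℚ.½ ℚ.+ ε ℚ.* ℚ.½ ≡ ε
  half+half ε = trans (sym (ℚ.*-distribˡ-+ ε ℚ.½ ℚ.½)) (ℚ.*-identityʳ ε)

  +-cauchy : ∀ {x y} → Cauchy x → Cauchy y → Cauchy (λ n → x n ℚ.+ y n)
  +-cauchy {x} {y} cx cy ε ε>0
    with M , hM ← cx (ε ℚ.* ℚ.½) (half ε ε>0)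
       | N , hN ← cy (ε ℚ.* ℚ.½) (half ε ε>0)
    = M ℕ.⊔ N , λ m n p q → begin-strict
      ℚ.∣ (x m ℚ.+ y m) ℚ.- (x n ℚ.+ y n) ∣
        ≡⟨ cong ℚ.∣_∣ (regroup (x m) (y m) (x n) (y n)) ⟩
      ℚ.∣ (x m ℚ.- x n) ℚ.+ (y m ℚ.- y n) ∣
        ≤⟨ ℚ.∣p+q∣≤∣p∣+∣q∣ (x m ℚ.- x n) (y m ℚ.- y n) ⟩
      ℚ.∣ x m ℚ.- x n ∣ ℚ.+ ℚ.∣ y m ℚ.- y n ∣
        <⟨ ℚ.+-mono-<
             (hM m n (ℕ.m⊔n≤o⇒m≤o M N p) (ℕ.m⊔n≤o⇒m≤o M N q))
             (hN m n (ℕ.m⊔n≤o⇒n≤o M N p) (ℕ.m⊔n≤o⇒n≤o M N q)) ⟩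
      ε ℚ.* ℚ.½ ℚ.+ ε ℚ.* ℚ.½
        ≡⟨ half+half ε ⟩
      ε ∎
    where
    open ℚ.≤-Reasoning
    regroup : ∀ a b c d → (a ℚ.+ b) ℚ.- (c ℚ.+ d) ≡ (a ℚ.- c) ℚ.+ (b ℚ.- d)
    regroup = solve 4 (λ a b c d → (a :+ b) :- (c :+ d) := (a :- c) :+ (b :- d)) refl
      where open +-*-Solver

  Bounded : Pred (ℕ → ℚ) 0ℓ
  Bounded x = ∃[ B ] 0ℚ ℚ.< B × ∃[ N ] ∀ n → N ℕ.≤ n → ℚ.∣ x n ∣ ℚ.≤ B

  bounded : ∀ {x} → Cauchy x → Bounded x
  bounded {x} cx with N , h ← cx 1ℚ (ℚ.positive⁻¹ 1ℚ)
    = 1ℚ ℚ.+ ℚ.∣ x N ∣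
    , ℚ.+-mono-<-≤ (ℚ.positive⁻¹ 1ℚ) (ℚ.0≤∣p∣ (x N))
    , N
    , λ n p → begin
      ℚ.∣ x n ∣
        ≡⟨ cong ℚ.∣_∣ (telescope (x n) (x N)) ⟩
      ℚ.∣ (x n ℚ.- x N) ℚ.+ x N ∣
        ≤⟨ ℚ.∣p+q∣≤∣p∣+∣q∣ (x n ℚ.- x N) (x N) ⟩
      ℚ.∣ x n ℚ.- x N ∣ ℚ.+ ℚ.∣ x N ∣
        ≤⟨ ℚ.+-monoˡ-≤ ℚ.∣ x N ∣ (ℚ.<⇒≤ (h n N p ℕ.≤-refl)) ⟩
      1ℚ ℚ.+ ℚ.∣ x N ∣ ∎
    where
    open ℚ.≤-Reasoning
    telescope : ∀ a b → a ≡ (a ℚ.- b) ℚ.+ b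
    telescope = solve 2 (λ a b → a := (a :- b) :+ b) refl
      where open +-*-Solver

  split : ∀ {A B ε} → 0ℚ ℚ.< A → 0ℚ ℚ.< B → 0ℚ ℚ.< ε →
          ∃[ δ ] 0ℚ ℚ.< δ × δ ℚ.* B ℚ.+ A ℚ.* δ ≡ ε
  split {A} {B} {ε} A>0 B>0 ε>0 = scale (A ℚ.+ B) refl (ℚ.+-mono-< A>0 B>0)
    where
    scale : ∀ C → A ℚ.+ B ≡ C → 0ℚ ℚ.< C → ∃[ δ ] 0ℚ ℚ.< δ × δ ℚ.* B ℚ.+ A ℚ.* δ ≡ ε
    scale C eq C>0 = ε ℚ.* C⁻¹ , δ>0 , total
      where
      open ≡-Reasoning
      C-pos = ℚ.positive C>0
      C-nonZero = ℚ.pos⇒nonZero C {{C-pos}}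
      C⁻¹ = ℚ.1/_ C {{C-nonZero}}

      δ>0 : 0ℚ ℚ.< ε ℚ.* C⁻¹
      δ>0 = subst (ℚ._< ε ℚ.* C⁻¹) (ℚ.*-zeroˡ C⁻¹)
        (ℚ.*-monoˡ-<-pos C⁻¹ {{ℚ.1/pos⇒pos C {{C-pos}}}} ε>0)

      total : (ε ℚ.* C⁻¹) ℚ.* B ℚ.+ A ℚ.* (ε ℚ.* C⁻¹) ≡ ε
      total = begin
        (ε ℚ.* C⁻¹) ℚ.* B ℚ.+ A ℚ.* (ε ℚ.* C⁻¹)  ≡⟨ cong ((ε ℚ.* C⁻¹) ℚ.* B ℚ.+_) (ℚ.*-comm A (ε ℚ.* C⁻¹)) ⟩
        (ε ℚ.* C⁻¹) ℚ.* B ℚ.+ (ε ℚ.* C⁻¹) ℚ.* A  ≡⟨ ℚ.*-distribˡ-+ (ε ℚ.* C⁻¹) B A ⟨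
        (ε ℚ.* C⁻¹) ℚ.* (B ℚ.+ A)                ≡⟨ cong ((ε ℚ.* C⁻¹) ℚ.*_) (trans (ℚ.+-comm B A) eq) ⟩
        (ε ℚ.* C⁻¹) ℚ.* C                        ≡⟨ ℚ.*-assoc ε C⁻¹ C ⟩
        ε ℚ.* (C⁻¹ ℚ.* C)                        ≡⟨ cong (ε ℚ.*_) (ℚ.*-inverseˡ C {{C-nonZero}}) ⟩
        ε ℚ.* 1ℚ                                 ≡⟨ ℚ.*-identityʳ ε ⟩
        ε                                        ∎

  product-bound : ∀ {A B δ} a b c d → 0ℚ ℚ.< A → 0ℚ ℚ.< B →
    ℚ.∣ b ∣ ℚ.≤ B → ℚ.∣ c ∣ ℚ.≤ A → ℚ.∣ a ℚ.- c ∣ ℚ.< δ → ℚ.∣ b ℚ.- d ∣ ℚ.< δ →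
    ℚ.∣ a ℚ.* b ℚ.- c ℚ.* d ∣ ℚ.< δ ℚ.* B ℚ.+ A ℚ.* δ
  product-bound {A} {B} {δ} a b c d A>0 B>0 b≤B c≤A a-c<δ b-d<δ = begin-strict
    ℚ.∣ a ℚ.* b ℚ.- c ℚ.* d ∣
      ≡⟨ cong ℚ.∣_∣ (regroup a b c d) ⟩
    ℚ.∣ (a ℚ.- c) ℚ.* b ℚ.+ c ℚ.* (b ℚ.- d) ∣
      ≤⟨ ℚ.∣p+q∣≤∣p∣+∣q∣ ((a ℚ.- c) ℚ.* b) (c ℚ.* (b ℚ.- d)) ⟩
    ℚ.∣ (a ℚ.- c) ℚ.* b ∣ ℚ.+ ℚ.∣ c ℚ.* (b ℚ.- d) ∣
      ≡⟨ cong₂ ℚ._+_ (ℚ.∣p*q∣≡∣p∣*∣q∣ (a ℚ.- c) b) (ℚ.∣p*q∣≡∣p∣*∣q∣ c (b ℚ.- d)) ⟩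
    ℚ.∣ a ℚ.- c ∣ ℚ.* ℚ.∣ b ∣ ℚ.+ ℚ.∣ c ∣ ℚ.* ℚ.∣ b ℚ.- d ∣
      <⟨ ℚ.+-mono-<-≤
           (ℚ.≤-<-trans
             (ℚ.*-monoˡ-≤-nonNeg ℚ.∣ a ℚ.- c ∣ {{ℚ.∣-∣-nonNeg (a ℚ.- c)}} b≤B)
             (ℚ.*-monoˡ-<-pos B {{ℚ.positive B>0}} a-c<δ))
           (ℚ.≤-trans
             (ℚ.*-monoʳ-≤-nonNeg ℚ.∣ b ℚ.- d ∣ {{ℚ.∣-∣-nonNeg (b ℚ.- d)}} c≤A)
             (ℚ.*-monoˡ-≤-nonNeg A {{ℚ.nonNegative (ℚ.<⇒≤ A>0)}} (ℚ.<⇒≤ b-d<δ))) ⟩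
    δ ℚ.* B ℚ.+ A ℚ.* δ ∎
    where
    open ℚ.≤-Reasoning
    regroup : ∀ a b c d → a ℚ.* b ℚ.- c ℚ.* d ≡ (a ℚ.- c) ℚ.* b ℚ.+ c ℚ.* (b ℚ.- d)
    regroup = solve 4 (λ a b c d → a :* b :- c :* d := (a :- c) :* b :+ c :* (b :- d)) refl
      where open +-*-Solver

  *-cauchy : ∀ {x y} → Cauchy x → Cauchy y → Cauchy (λ n → x n ℚ.* y n)
  *-cauchy {x} {y} cx cy ε ε>0 = bound (bounded cx) (bounded cy)
    where
    Goal : Set
    Goal = ∃[ N ] ∀ m n → N ℕ.≤ m → N ℕ.≤ n → ℚ.∣ x m ℚ.* y m ℚ.- x n ℚ.* y n ∣ ℚ.< ε

    Close : (ℕ → ℚ) → ℚ → Set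
    Close x δ = ∃[ N ] ∀ m n → N ℕ.≤ m → N ℕ.≤ n → ℚ.∣ x m ℚ.- x n ∣ ℚ.< δ

    bound : Bounded x → Bounded y → Goal
    bound (A , A>0 , K , hK) (B , B>0 , L , hL) = pick (split A>0 B>0 ε>0)
      where
      combine : ∀ {δ} → δ ℚ.* B ℚ.+ A ℚ.* δ ≡ ε → Close x δ → Close y δ → Goal
      combine total (M , hM) (N , hN) = (K ℕ.⊔ L) ℕ.⊔ (M ℕ.⊔ N) , λ m n p q →
        let
          KL≤m = ℕ.m⊔n≤o⇒m≤o (K ℕ.⊔ L) (M ℕ.⊔ N) p
          KL≤n = ℕ.m⊔n≤o⇒m≤o (K ℕ.⊔ L) (M ℕ.⊔ N) q
          MN≤m = ℕ.m⊔n≤o⇒n≤o (K ℕ.⊔ L) (M ℕ.⊔ N) p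
          MN≤n = ℕ.m⊔n≤o⇒n≤o (K ℕ.⊔ L) (M ℕ.⊔ N) q
        in subst (ℚ.∣ x m ℚ.* y m ℚ.- x n ℚ.* y n ∣ ℚ.<_) total
          (product-bound (x m) (y m) (x n) (y n) A>0 B>0
            (hL m (ℕ.m⊔n≤o⇒n≤o K L KL≤m))
            (hK n (ℕ.m⊔n≤o⇒m≤o K L KL≤n))
            (hM m n (ℕ.m⊔n≤o⇒m≤o M N MN≤m) (ℕ.m⊔n≤o⇒m≤o M N MN≤n))
            (hN m n (ℕ.m⊔n≤o⇒n≤o M N MN≤m) (ℕ.m⊔n≤o⇒n≤o M N MN≤n)))

      pick : (∃[ δ ] 0ℚ ℚ.< δ × δ ℚ.* B ℚ.+ A ℚ.* δ ≡ ε) → Goal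
      pick (δ , δ>0 , total) = combine total (cx δ δ>0) (cy δ δ>0)

infixl 6 _+_
infixl 7 _*_

_+_ : ℝ → ℝ → ℝ
x + y = mkℝ (λ n → seq x n ℚ.+ seq y n) (+-cauchy {seq x} {seq y} (cauchy x) (cauchy y))

_*_ : ℝ → ℝ → ℝ
x * y = mkℝ (λ n → seq x n ℚ.* seq y n) (*-cauchy {seq x} {seq y} (cauchy x) (cauchy y))

IsFloor : ℤ → ℝ → Set
IsFloor k x = fromℤ k ≤ x × x < fromℤ (k ℤ.+ 1ℤ)

private
  between : ∀ x → ∃[ k ] fromℤ k ≤ x × x < fromℤ (k ℤ.+ 1ℤ ℤ.+ 1ℤ ℤ.+ 1ℤ)
  between x with N , h ← cauchy x 1ℚ (ℚ.positive⁻¹ 1ℚ) = k , lower , upper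
    where
    open ℚ.≤-Reasoning
    f = ℚ.floor (seq x N)
    F = ℤ→ℚ f
    k = f ℤ.+ -1ℤ

    close : ∀ a b → ℚ.∣ a ℚ.- b ∣ ℚ.< 1ℚ → a ℚ.< b ℚ.+ 1ℚ
    close a b p = begin-strict
      a                     ≡⟨ solve 2 (λ a b → a := b :+ (a :- b)) refl a b ⟩
      b ℚ.+ (a ℚ.- b)       ≤⟨ ℚ.+-monoʳ-≤ b (p≤∣p∣ (a ℚ.- b)) ⟩
      b ℚ.+ ℚ.∣ a ℚ.- b ∣   <⟨ ℚ.+-monoʳ-< b p ⟩
      b ℚ.+ 1ℚ              ∎
      where
      open +-*-Solver
      p≤∣p∣ : ∀ p → p ℚ.≤ ℚ.∣ p ∣
      p≤∣p∣ p with ℚ.≤-total 0ℚ p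
      ... | inj₁ 0≤p = ℚ.≤-reflexive (sym (ℚ.0≤p⇒∣p∣≡p 0≤p))
      ... | inj₂ p≤0 = ℚ.≤-trans p≤0 (ℚ.0≤∣p∣ p)

    lower : fromℤ k ≤ x
    lower (ε , ε>0 , M , g) = ℚ.<-irrefl refl (begin-strict
      F                            ≤⟨ floor-≤ (seq x N) ⟩
      seq x N                      <⟨ close (seq x N) (seq x n) (h N n ℕ.≤-refl (ℕ.m≤n⊔m M N)) ⟩
      seq x n ℚ.+ 1ℚ               ≡⟨ cong (ℚ._+ 1ℚ) (ℚ.+-identityʳ (seq x n)) ⟨
      (seq x n ℚ.+ 0ℚ) ℚ.+ 1ℚ      <⟨ ℚ.+-monoˡ-< 1ℚ (ℚ.+-monoʳ-< (seq x n) ε>0) ⟩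
      (seq x n ℚ.+ ε) ℚ.+ 1ℚ       ≤⟨ ℚ.+-monoˡ-≤ 1ℚ (g n (ℕ.m≤m⊔n M N)) ⟩
      ℤ→ℚ k ℚ.+ 1ℚ                 ≡⟨ ℤ→ℚ-+ k 1ℤ ⟨
      ℤ→ℚ (k ℤ.+ 1ℤ)               ≡⟨ cong ℤ→ℚ (trans (ℤ.+-assoc f -1ℤ 1ℤ) (ℤ.+-identityʳ f)) ⟩
      F                            ∎)
      where n = M ℕ.⊔ N

    top : ℤ→ℚ (k ℤ.+ 1ℤ ℤ.+ 1ℤ ℤ.+ 1ℤ) ≡ F ℚ.+ 1ℚ ℚ.+ 1ℚ
    top = begin-equality
      ℤ→ℚ (k ℤ.+ 1ℤ ℤ.+ 1ℤ ℤ.+ 1ℤ)  ≡⟨ cong (λ i → ℤ→ℚ (i ℤ.+ 1ℤ ℤ.+ 1ℤ)) (trans (ℤ.+-assoc f -1ℤ 1ℤ) (ℤ.+-identityʳ f)) ⟩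
      ℤ→ℚ (f ℤ.+ 1ℤ ℤ.+ 1ℤ)         ≡⟨ ℤ→ℚ-+ (f ℤ.+ 1ℤ) 1ℤ ⟩
      ℤ→ℚ (f ℤ.+ 1ℤ) ℚ.+ 1ℚ         ≡⟨ cong (ℚ._+ 1ℚ) (ℤ→ℚ-+ f 1ℤ) ⟩
      F ℚ.+ 1ℚ ℚ.+ 1ℚ               ∎

    ε = F ℚ.+ 1ℚ ℚ.- seq x N

    upper : x < fromℤ (k ℤ.+ 1ℤ ℤ.+ 1ℤ ℤ.+ 1ℤ)
    upper
      = ε
      , subst (ℚ._< ε) (ℚ.+-inverseʳ (seq x N)) (ℚ.+-monoˡ-< (ℚ.- seq x N) (<-floor+1 (seq x N)))
      , N
      , λ n p → begin
        seq x n ℚ.+ ε                     ≤⟨ ℚ.+-monoˡ-≤ ε (ℚ.<⇒≤ (close (seq x n) (seq x N) (h n N p ℕ.≤-refl))) ⟩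
        (seq x N ℚ.+ 1ℚ) ℚ.+ ε            ≡⟨ solve 3 (λ a u b → (a :+ u) :+ (b :+ u :- a) := b :+ u :+ u) refl (seq x N) 1ℚ F ⟩
        F ℚ.+ 1ℚ ℚ.+ 1ℚ                   ≡⟨ top ⟨
        ℤ→ℚ (k ℤ.+ 1ℤ ℤ.+ 1ℤ ℤ.+ 1ℤ)      ∎
      where open +-*-Solver

-- The floor is discontinuous, so it is total on ℝ only classically.
floor-exists : ExcludedMiddle 0ℓ → ∀ x → ∃[ k ] IsFloor k x
floor-exists em x = narrow (between x)
  where
  narrow : (∃[ k ] fromℤ k ≤ x × x < fromℤ (k ℤ.+ 1ℤ ℤ.+ 1ℤ ℤ.+ 1ℤ)) → ∃[ k ] IsFloor k x
  narrow (k , k≤x , x<k+3) = choose em em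
    where
    choose : Dec (x < fromℤ (k ℤ.+ 1ℤ)) → Dec (x < fromℤ (k ℤ.+ 1ℤ ℤ.+ 1ℤ)) → ∃[ k ] IsFloor k x
    choose (yes x<k+1) _           = k , k≤x , x<k+1
    choose (no  k+1≤x) (yes x<k+2) = k ℤ.+ 1ℤ , k+1≤x , x<k+2
    choose (no  _)     (no  k+2≤x) = k ℤ.+ 1ℤ ℤ.+ 1ℤ , k+2≤x , x<k+3

ℝ² : Set
ℝ² = ℝ × ℝ

UltimatelyPeriodic : (ℕ → ℤ) → Set
UltimatelyPeriodic a =
  ∃[ n₀ ] ∃[ p ] 0 ℕ.< p × (∀ n → n₀ ℕ.≤ n → a (n ℕ.+ p) ≡ a n)

EventuallyZero : (ℕ → ℤ) → Set
EventuallyZero a = ∃[ n₀ ] ∀ n → n₀ ℕ.≤ n → a n ≡ 0ℤ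

-- p need not be the least period, so (0,…,0) is a way of writing the trivial
-- cycle (0).
Nontrivial : Pred (List ℤ) 0ℓ
Nontrivial c = ¬ All (_≡ 0ℤ) c

SameSign : Pred (List ℤ) 0ℓ
SameSign c = All (ℤ._> 0ℤ) c ⊎ All (ℤ._< 0ℤ) c

Strip : Pred ℝ² 0ℓ
Strip (r₀ , r₁) = fromℤ (ℤ.- (+ 2)) < r₀ + r₁ × r₀ + r₁ < fromℤ 0ℤ

module ShiftRadixSystem (em : ExcludedMiddle 0ℓ) where

  ⌊_⌋ : ℝ → ℤ
  ⌊ x ⌋ = proj₁ (floor-exists em x)

  τ : ℝ² → ℤ × ℤ → ℤ × ℤ
  τ (r₀ , r₁) (a₀ , a₁) = a₁ , ℤ.- ⌊ r₀ * fromℤ a₀ + r₁ * fromℤ a₁ ⌋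

  -- τ shifts its argument, so the sequence aₙ consists of the first coordinates
  -- of the iterates.
  orbit : ℝ² → ℤ × ℤ → ℕ → ℤ
  orbit r z n = proj₁ (fold z (τ r) n)

  IsCycle : ℝ² → Pred (List ℤ) 0ℓ
  IsCycle r c =
    ∃[ z ] ∃[ n₀ ] ∃[ p ] 0 ℕ.< p
      × (∀ n → n₀ ℕ.≤ n → orbit r z (n ℕ.+ p) ≡ orbit r z n)
      × ∃[ n ] n₀ ℕ.≤ n × c ≡ applyUpTo (λ i → orbit r z (n ℕ.+ i)) p

  𝒟₂* : Pred ℝ² 0ℓ
  𝒟₂* r = ∀ z → UltimatelyPeriodic (orbit r z) → EventuallyZero (orbit r z)

{-# OPTIONS --safe #-}

-- A sequence a with aⱼ₊₂ = −⌊r₀aⱼ + r₁aⱼ₊₁⌋ satisfies |r₀aⱼ + r₁aⱼ₊₁ + aⱼ₊₂| < 1.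
-- Let S be the sum of a over a period.  Since |aⱼ| ≥ 1 and the aⱼ have constant
-- sign, adding these bounds over the period gives |(r₀ + r₁ + 1)S| < |S|, that
-- is |r₀ + r₁ + 1| < 1.  Conversely, if −2 < r₀ + r₁ < 0, then (1,1) or (−1,−1)
-- is a fixed point of τ.
module Submission where

open import Axiom.ExcludedMiddle using (ExcludedMiddle)
open import Data.Integer as ℤ using (+_; 0ℤ; 1ℤ; -1ℤ)
open import Data.List.Base using (_∷_; [])
open import Data.Product using (∃-syntax; _×_; _,_)
open import Function.Bundles using (_⇔_)
open import Level using (0ℓ)
open import Relation.Unary using (Empty; _∩_)
open import Defs

open import Algebra.Properties.Group using (inverseˡ-unique; ∙-cancelʳ)
open import Data.Integer using (ℤ)
import Data.Integer.Properties as ℤ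
open import Data.List.Base using (applyUpTo)
open import Data.List.Relation.Unary.All as All using ([]; _∷_)
open import Data.List.Relation.Unary.All.Properties using (applyUpTo⁻)
open import Data.Nat as ℕ using (ℕ; zero; suc; z≤n; s≤s)
open import Data.Nat.GeneralisedArithmetic using (fold)
import Data.Nat.Properties as ℕ
open import Data.Product using (map₂; proj₁; proj₂)
open import Data.Rational as ℚ using (ℚ; 0ℚ; 1ℚ; ½)
import Data.Rational.Properties as ℚ
open import Data.Rational.Solver using (module +-*-Solver)
import Data.Rational.Unnormalised as ℚᵘ
import Data.Rational.Unnormalised.Properties as ℚᵘ
open import Data.Sum using (inj₁; inj₂; [_,_]′)
open import Function using (_∘_; const)
open import Function.Bundles using (mk⇔)
open import Relation.Binary.PropositionalEquality
open import Relation.Nullary using (¬_; yes; no; contradiction)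

open +-*-Solver using (solve; con; _:+_; _:*_; _:-_; :-_; _:=_)

-- Rational inequalities and the embedding of the integers.

¼ : ℚ
¼ = ½ ℚ.* ½

p≤∣p∣ : ∀ p → p ℚ.≤ ℚ.∣ p ∣
p≤∣p∣ p with ℚ.≤-total 0ℚ p
... | inj₁ 0≤p = ℚ.≤-reflexive (sym (ℚ.0≤p⇒∣p∣≡p 0≤p))
... | inj₂ p≤0 = ℚ.≤-trans p≤0 (ℚ.0≤∣p∣ p)

-- Transfers an inequality by an identity between differences, which the ring solver can check.
≤-by-difference : ∀ {p q s t} → q ℚ.- p ≡ t ℚ.- s → p ℚ.≤ q → s ℚ.≤ t
≤-by-difference {p} {q} {s} {t} eq p≤q = begin
  s                    ≡⟨ solve 2 (λ p s → s := p :+ (s :- p)) refl p s ⟩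
  p ℚ.+ (s ℚ.- p)      ≤⟨ ℚ.+-monoˡ-≤ (s ℚ.- p) p≤q ⟩
  q ℚ.+ (s ℚ.- p)      ≡⟨ solve 3 (λ p q s → q :+ (s :- p) := (q :- p) :+ s) refl p q s ⟩
  (q ℚ.- p) ℚ.+ s      ≡⟨ cong (ℚ._+ s) eq ⟩
  (t ℚ.- s) ℚ.+ s      ≡⟨ solve 2 (λ s t → (t :- s) :+ s := t) refl s t ⟩
  t                    ∎
  where open ℚ.≤-Reasoning

ℤ→ℚ-neg : ∀ i → ℤ→ℚ (ℤ.- i) ≡ ℚ.- ℤ→ℚ i
ℤ→ℚ-neg i = inverseˡ-unique ℚ.+-0-group (ℤ→ℚ (ℤ.- i)) (ℤ→ℚ i)
  (trans (sym (ℤ→ℚ-+ (ℤ.- i) i)) (cong ℤ→ℚ (ℤ.+-inverseˡ i)))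

ℤ→ℚ-mono-≤ : ∀ {i j} → i ℤ.≤ j → ℤ→ℚ i ℚ.≤ ℤ→ℚ j
ℤ→ℚ-mono-≤ {i} {j} i≤j = ℚ.toℚᵘ-cancel-≤
  (ℚᵘ.≤-respˡ-≃ (ℚᵘ.≃-sym (toℚᵘ-ℤ→ℚ i))
    (ℚᵘ.≤-respʳ-≃ (ℚᵘ.≃-sym (toℚᵘ-ℤ→ℚ j))
      (ℚᵘ.*≤* (ℤ.*-monoʳ-≤-nonNeg 1ℤ i≤j))))

-- Eventual separation of rational sequences.

infix 4 _≺_

-- A record, unlike _<_, lets Agda infer the two sequences from a proof.
record _≺_ (x y : ℕ → ℚ) : Set where
  constructor mk≺
  field
    separated : ∃[ ε ] 0ℚ ℚ.< ε × ∃[ N ] ∀ n → N ℕ.≤ n → x n ℚ.+ ε ℚ.≤ y n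

<⇒≺ : ∀ x y → x < y → seq x ≺ seq y
<⇒≺ _ _ = mk≺

≺⇒< : ∀ x y → seq x ≺ seq y → x < y
≺⇒< _ _ = _≺_.separated

-- A gap `ε` between `x` and `y` leaves a gap `ε / c` between `u` and `v`. The rearrangement lemmas
-- below are the case `c = 1`.
≺-scale : ∀ {x y u v} c → 0ℚ ℚ.< c →
  (∀ n → y n ℚ.- x n ℚ.≤ c ℚ.* (v n ℚ.- u n)) → x ≺ y → u ≺ v
≺-scale {x} {y} {u} {v} c c>0 le (mk≺ (ε , ε>0 , N , h)) = mk≺ (δ , δ>0 , N , bound)
  where
  instance
    c-pos = ℚ.positive c>0
    c-nonZero = ℚ.pos⇒nonZero c

  c⁻¹ = ℚ.1/ c
  δ = c⁻¹ ℚ.* ε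

  δ>0 : 0ℚ ℚ.< δ
  δ>0 = subst (ℚ._< δ) (ℚ.*-zeroʳ c⁻¹) (ℚ.*-monoʳ-<-pos c⁻¹ {{ℚ.1/pos⇒pos c}} ε>0)

  c*δ≡ε : c ℚ.* δ ≡ ε
  c*δ≡ε = trans (sym (ℚ.*-assoc c c⁻¹ ε))
    (trans (cong (ℚ._* ε) (ℚ.*-inverseʳ c)) (ℚ.*-identityˡ ε))

  bound : ∀ n → N ℕ.≤ n → u n ℚ.+ δ ℚ.≤ v n
  bound n p = ≤-by-difference
    (solve 3 (λ u v δ → (v :- u) :- δ := v :- (u :+ δ)) refl (u n) (v n) δ)
    (ℚ.*-cancelˡ-≤-pos c (begin
      c ℚ.* δ                ≡⟨ c*δ≡ε ⟩
      ε                      ≤⟨ ≤-by-difference (solve 3 (λ x y ε → y :- (x :+ ε) := (y :- x) :- ε) refl (x n) (y n) ε) (h n p) ⟩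
      y n ℚ.- x n            ≤⟨ le n ⟩
      c ℚ.* (v n ℚ.- u n)    ∎))
    where open ℚ.≤-Reasoning

≺-widen : ∀ {x y u v} → (∀ n → y n ℚ.- x n ℚ.≤ v n ℚ.- u n) → x ≺ y → u ≺ v
≺-widen {u = u} {v} le = ≺-scale 1ℚ (ℚ.positive⁻¹ 1ℚ) λ n →
  ℚ.≤-trans (le n) (ℚ.≤-reflexive (sym (ℚ.*-identityˡ (v n ℚ.- u n))))

≺-rearrange : ∀ {x y u v} → (∀ n → y n ℚ.- x n ≡ v n ℚ.- u n) → x ≺ y → u ≺ v
≺-rearrange eq = ≺-widen (ℚ.≤-reflexive ∘ eq)

≺-+ : ∀ {x y u v} → x ≺ y → u ≺ v →
  (λ n → x n ℚ.+ u n) ≺ (λ n → y n ℚ.+ v n)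
≺-+ {x} {y} {u} {v} (mk≺ (ε , ε>0 , M , g)) (mk≺ (δ , δ>0 , N , h))
  = mk≺ (ε ℚ.+ δ , ℚ.+-mono-< ε>0 δ>0 , M ℕ.⊔ N , λ n p →
    subst (ℚ._≤ y n ℚ.+ v n)
      (solve 4 (λ x ε u δ → (x :+ ε) :+ (u :+ δ) := (x :+ u) :+ (ε :+ δ)) refl (x n) ε (u n) δ)
      (ℚ.+-mono-≤ (g n (ℕ.m⊔n≤o⇒m≤o M N p)) (h n (ℕ.m⊔n≤o⇒n≤o M N p))))

≺-irrefl : ∀ {x} → ¬ (x ≺ x)
≺-irrefl {x} (mk≺ (ε , ε>0 , N , h)) = ℚ.<-irrefl refl (ℚ.<-≤-trans
  (subst (ℚ._< x N ℚ.+ ε) (ℚ.+-identityʳ (x N)) (ℚ.+-monoʳ-< (x N) ε>0))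
  (h N ℕ.≤-refl))

-- Since `≤` is a negation, the gap has to be found. Beyond some `N` the sequence varies by less
-- than `¼`, and comparing `q` with `seq x N + ½` is decidable: either `seq x n + 1` stays above `q`
-- by `¼`, or `seq x n` stays below `q` by `¼`, against `q ≤ x`.
≤⇒≺+1 : ∀ {q x} → ℚ→ℝ q ≤ x → const q ≺ (λ n → seq x n ℚ.+ 1ℚ)
≤⇒≺+1 {q} {x} q≤x with cauchy x ¼ (ℚ.positive⁻¹ ¼)
... | N , h with q ℚ.≤? seq x N ℚ.+ ½
...   | yes near = mk≺ (¼ , ℚ.positive⁻¹ ¼ , N , λ n p →
        ≤-by-difference
          (solve 3 (λ q a b → (a :+ con ½ :+ con ¼) :- (q :+ (a :- b)) := (b :+ con 1ℚ) :- (q :+ con ¼))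
            refl q (seq x N) (seq x n))
          (ℚ.+-mono-≤ near (ℚ.≤-trans (p≤∣p∣ (seq x N ℚ.- seq x n)) (ℚ.<⇒≤ (h N n ℕ.≤-refl p)))))
...   | no far = contradiction (¼ , ℚ.positive⁻¹ ¼ , N , λ n p →
        ≤-by-difference
          (solve 3 (λ q a b → (q :+ con ¼) :- ((a :+ con ½) :+ (b :- a)) := q :- (b :+ con ¼))
            refl q (seq x N) (seq x n))
          (ℚ.+-mono-≤ (ℚ.<⇒≤ (ℚ.≰⇒> far))
            (ℚ.≤-trans (p≤∣p∣ (seq x n ℚ.- seq x N)) (ℚ.<⇒≤ (h n N p ℕ.≤-refl)))))
        q≤x

-- Two-sided strict bounds and floors.

-- The bound `|x| < c` written without an absolute value, so that both halves can be added and
-- rescaled by ring identities.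
Within : ℚ → (ℕ → ℚ) → Set
Within c x = x ≺ const c × (ℚ.-_ ∘ x) ≺ const c

Within-cong : ∀ {c x y} → (∀ n → x n ≡ y n) → Within c x → Within c y
Within-cong {c} x≡y (x≺c , -x≺c)
  = ≺-rearrange (λ n → cong (ℚ._-_ c) (x≡y n)) x≺c
  , ≺-rearrange (λ n → cong (λ p → c ℚ.- (ℚ.- p)) (x≡y n)) -x≺c

Within-neg : ∀ {c x} → Within c x → Within c (ℚ.-_ ∘ x)
Within-neg {c} {x} (x≺c , -x≺c)
  = -x≺c
  , ≺-rearrange (λ n → solve 2 (λ c p → c :- p := c :- (:- (:- p))) refl c (x n)) x≺c

Within-mono : ∀ {c d x} → c ℚ.≤ d → Within c x → Within d x
Within-mono {x = x} c≤d (x≺c , -x≺c)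
  = ≺-widen (λ n → ℚ.+-monoˡ-≤ (ℚ.- x n) c≤d) x≺c
  , ≺-widen (λ n → ℚ.+-monoˡ-≤ (ℚ.- (ℚ.- x n)) c≤d) -x≺c

Within-+ : ∀ {c d x y} → Within c x → Within d y → Within (c ℚ.+ d) (λ n → x n ℚ.+ y n)
Within-+ {c} {d} {x} {y} (x≺c , -x≺c) (y≺d , -y≺d)
  = ≺-+ x≺c y≺d
  , ≺-rearrange
      (λ n → solve 4 (λ c d p q → (c :+ d) :- (:- p :+ :- q) := (c :+ d) :- (:- (p :+ q))) refl c d (x n) (y n))
      (≺-+ -x≺c -y≺d)

Within-*-cancel : ∀ {c x} → 0ℚ ℚ.< c → Within c (λ n → x n ℚ.* c) → Within 1ℚ x
Within-*-cancel {c} {x} c>0 (xc≺c , -xc≺c)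
  = ≺-scale c c>0 (λ n → ℚ.≤-reflexive (solve 2 (λ c p → c :- p :* c := c :* (con 1ℚ :- p)) refl c (x n))) xc≺c
  , ≺-scale c c>0 (λ n → ℚ.≤-reflexive (solve 2 (λ c p → c :- (:- (p :* c)) := c :* (con 1ℚ :- (:- p))) refl c (x n))) -xc≺c

Within⇒Strip : ∀ r₀ r₁ → Within 1ℚ (λ n → seq r₀ n ℚ.+ seq r₁ n ℚ.+ 1ℚ) → Strip (r₀ , r₁)
Within⇒Strip r₀ r₁ (t≺1 , -t≺1)
  = ≺⇒< (fromℤ (ℤ.- (+ 2))) (r₀ + r₁) (≺-rearrange (λ n → solve 2 (λ a b → con 1ℚ :- (:- (a :+ b :+ con 1ℚ)) := (a :+ b) :- con (ℤ→ℚ (ℤ.- (+ 2)))) refl (seq r₀ n) (seq r₁ n)) -t≺1)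
  , ≺⇒< (r₀ + r₁) (fromℤ 0ℤ) (≺-rearrange (λ n → solve 2 (λ a b → con 1ℚ :- (a :+ b :+ con 1ℚ) := con 0ℚ :- (a :+ b)) refl (seq r₀ n) (seq r₁ n)) t≺1)

-- The bound `k ≤ x` is weak, but only `k - 1 < x` is required, and the spare unit yields a strict
-- gap.
floor⇒Within : ∀ k x → IsFloor k x → Within 1ℚ (λ n → seq x n ℚ.- ℤ→ℚ k)
floor⇒Within k x (k≤x , x<k+1)
  = ≺-rearrange (λ n → trans (cong (ℚ._- seq x n) (ℤ→ℚ-+ k 1ℤ))
      (solve 2 (λ k p → (k :+ con 1ℚ) :- p := con 1ℚ :- (p :- k)) refl (ℤ→ℚ k) (seq x n))) (<⇒≺ x (fromℤ (k ℤ.+ 1ℤ)) x<k+1)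
  , ≺-rearrange (λ n → solve 2 (λ k p → (p :+ con 1ℚ) :- k := con 1ℚ :- (:- (p :- k))) refl (ℤ→ℚ k) (seq x n))
      (≤⇒≺+1 {x = x} k≤x)

floor-≤-floor : ∀ k l x → IsFloor k x → IsFloor l x → k ℤ.≤ l
floor-≤-floor k l x (k≤x , _) (_ , x<l+1) = ℤ.≮⇒≥ λ l<k →
  k≤x (≺⇒< x (fromℤ k) (≺-widen
    (λ n → ℚ.+-monoˡ-≤ (ℚ.- seq x n)
      (ℤ→ℚ-mono-≤ (subst (ℤ._≤ k) (ℤ.+-comm 1ℤ l) (ℤ.i<j⇒suc[i]≤j l<k))))
    (<⇒≺ x (fromℤ (l ℤ.+ 1ℤ)) x<l+1)))

-- The floor is chosen by excluded middle, so its value is identified through `IsFloor` and not by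
-- computation.
floor-unique : ∀ k l x → IsFloor k x → IsFloor l x → k ≡ l
floor-unique k l x p q = ℤ.≤-antisym (floor-≤-floor k l x p q) (floor-≤-floor l k x q p)

-- Sums over a period.

-- Includes the last index: S w n = w₀ + ⋯ + wₙ.
S : (ℕ → ℚ) → ℕ → ℚ
S w zero    = w 0
S w (suc n) = S w n ℚ.+ w (suc n)

-- The shift drops `w 0` and appends `w (suc n)`, which are equal. In `telescope` both sides are the
-- sum of all terms from `w 0` to `w (suc n)`.
S-shift : ∀ w n → w (suc n) ≡ w 0 → S (w ∘ suc) n ≡ S w n
S-shift w n eq = ∙-cancelʳ ℚ.+-0-group (w 0) (S (w ∘ suc) n) (S w n)
  (trans (telescope n) (cong (S w n ℚ.+_) eq))
  where
  telescope : ∀ n → S (w ∘ suc) n ℚ.+ w 0 ≡ S w n ℚ.+ w (suc n)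
  telescope zero    = ℚ.+-comm (w 1) (w 0)
  telescope (suc n) = begin
    (S (w ∘ suc) n ℚ.+ w (2 ℕ.+ n)) ℚ.+ w 0    ≡⟨ solve 3 (λ s a b → (s :+ a) :+ b := (s :+ b) :+ a) refl (S (w ∘ suc) n) (w (2 ℕ.+ n)) (w 0) ⟩
    (S (w ∘ suc) n ℚ.+ w 0) ℚ.+ w (2 ℕ.+ n)    ≡⟨ cong (ℚ._+ w (2 ℕ.+ n)) (telescope n) ⟩
    (S w n ℚ.+ w (suc n)) ℚ.+ w (2 ℕ.+ n)      ∎
    where open ≡-Reasoning

S-positive : ∀ w n → (∀ j → j ℕ.≤ n → 1ℚ ℚ.≤ w j) → 0ℚ ℚ.< S w n
S-positive w zero    1≤w = ℚ.<-≤-trans (ℚ.positive⁻¹ 1ℚ) (1≤w 0 z≤n)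
S-positive w (suc n) 1≤w = ℚ.+-mono-<
  (S-positive w n (λ j → 1≤w j ∘ ℕ.m≤n⇒m≤1+n))
  (ℚ.<-≤-trans (ℚ.positive⁻¹ 1ℚ) (1≤w (suc n) ℕ.≤-refl))

-- From a periodic sequence of constant sign to the strip.

module _ (r₀ r₁ : ℝ) where

  -- The index `n` runs through the approximations of `r₀` and `r₁`, not through the orbit.
  combination : ℚ → ℚ → ℚ → ℕ → ℚ
  combination a b c n = seq r₀ n ℚ.* a ℚ.+ seq r₁ n ℚ.* b ℚ.+ c

  -- Each bound 1 is first weakened to the term `w j`, so that the bounds add up to the sum itself.
  S-Within : ∀ w n → (∀ j → j ℕ.≤ n → 1ℚ ℚ.≤ w j) →
    (∀ j → Within 1ℚ (combination (w j) (w (1 ℕ.+ j)) (w (2 ℕ.+ j)))) →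
    Within (S w n) (combination (S w n) (S (w ∘ suc) n) (S (w ∘ suc ∘ suc) n))
  S-Within w zero    1≤w h = Within-mono (1≤w 0 z≤n) (h 0)
  S-Within w (suc n) 1≤w h = Within-cong
    (λ m → solve 8 (λ p q a b c a′ b′ c′ →
        (p :* a :+ q :* b :+ c) :+ (p :* a′ :+ q :* b′ :+ c′)
          := p :* (a :+ a′) :+ q :* (b :+ b′) :+ (c :+ c′)) refl
      (seq r₀ m) (seq r₁ m) (S w n) (S (w ∘ suc) n) (S (w ∘ suc ∘ suc) n)
      (w (1 ℕ.+ n)) (w (2 ℕ.+ n)) (w (3 ℕ.+ n)))
    (Within-+ (S-Within w n (λ j → 1≤w j ∘ ℕ.m≤n⇒m≤1+n) h)
      (Within-mono (1≤w (suc n) ℕ.≤-refl) (h (suc n))))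

  -- The shifts by one and by two leave the sum unchanged, which takes just the two wrap-around
  -- equations. The linear form is then `r₀ + r₁ + 1` times a positive sum, which cancels.
  periodic⇒Strip : ∀ w n → w (1 ℕ.+ n) ≡ w 0 → w (2 ℕ.+ n) ≡ w 1 →
    (∀ j → j ℕ.≤ n → 1ℚ ℚ.≤ w j) →
    (∀ j → Within 1ℚ (combination (w j) (w (1 ℕ.+ j)) (w (2 ℕ.+ j)))) →
    Strip (r₀ , r₁)
  periodic⇒Strip w n eq₀ eq₁ 1≤w h = Within⇒Strip r₀ r₁
    (Within-*-cancel (S-positive w n 1≤w) (Within-cong factor (S-Within w n 1≤w h)))
    where
    factor : ∀ m → combination (S w n) (S (w ∘ suc) n) (S (w ∘ suc ∘ suc) n) m
                 ≡ (seq r₀ m ℚ.+ seq r₁ m ℚ.+ 1ℚ) ℚ.* S w n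
    factor m = trans
      (cong₂ (λ b c → combination (S w n) b c m)
        (S-shift w n eq₀) (trans (S-shift (w ∘ suc) n eq₁) (S-shift w n eq₀)))
      (solve 3 (λ p q s → p :* s :+ q :* s :+ s := (p :+ q :+ con 1ℚ) :* s) refl
        (seq r₀ m) (seq r₁ m) (S w n))

  recurrence⇒Within : ∀ a b c → IsFloor (ℤ.- c) (r₀ * fromℤ a + r₁ * fromℤ b) →
    Within 1ℚ (combination (ℤ→ℚ a) (ℤ→ℚ b) (ℤ→ℚ c))
  recurrence⇒Within a b c isFloor = Within-cong
    (λ n → trans (cong (ℚ._-_ (seq r₀ n ℚ.* ℤ→ℚ a ℚ.+ seq r₁ n ℚ.* ℤ→ℚ b)) (ℤ→ℚ-neg c))
      (solve 2 (λ p c → p :- (:- c) := p :+ c) refl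
        (seq r₀ n ℚ.* ℤ→ℚ a ℚ.+ seq r₁ n ℚ.* ℤ→ℚ b) (ℤ→ℚ c)))
    (floor⇒Within (ℤ.- c) (r₀ * fromℤ a + r₁ * fromℤ b) isFloor)

  -- Stated through `IsFloor` and not as an equation with a floor function, so that this part does
  -- without excluded middle.
  Recurrence : (ℕ → ℤ) → Set
  Recurrence a = ∀ n →
    IsFloor (ℤ.- a (2 ℕ.+ n)) (r₀ * fromℤ (a n) + r₁ * fromℤ (a (1 ℕ.+ n)))

  -- With period `suc p`, the indices from 0 to `p` cover exactly one period.
  sameSign⇒Strip : ∀ a n p → (∀ m → n ℕ.≤ m → a (m ℕ.+ suc p) ≡ a m) →
    Recurrence a → SameSign (applyUpTo (λ i → a (n ℕ.+ i)) (suc p)) → Strip (r₀ , r₁)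
  sameSign⇒Strip a n p periodic recurrence =
    [ (λ b>0 → periodic⇒Strip w p (cong ℤ→ℚ eq₀) (cong ℤ→ℚ eq₁)
        (λ j j≤p → ℤ→ℚ-mono-≤ (ℤ.i<j⇒suc[i]≤j (applyUpTo⁻ b (suc p) b>0 (s≤s j≤p))))
        w-Within)
    -- The linear form is odd and the bounds are symmetric, so the negative case is the positive one
    -- for the negated sequence.
    , (λ b<0 → periodic⇒Strip (ℚ.-_ ∘ w) p (cong (ℚ.-_ ∘ ℤ→ℚ) eq₀) (cong (ℚ.-_ ∘ ℤ→ℚ) eq₁)
        (λ j j≤p → subst (1ℚ ℚ.≤_) (ℤ→ℚ-neg (b j))
          (ℤ→ℚ-mono-≤ (ℤ.i<j⇒suc[i]≤j (ℤ.neg-mono-< (applyUpTo⁻ b (suc p) b<0 (s≤s j≤p))))))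
        (λ j → Within-cong
          (λ m → solve 5 (λ p q a b c →
              :- (p :* a :+ q :* b :+ c) := p :* (:- a) :+ q :* (:- b) :+ (:- c)) refl
            (seq r₀ m) (seq r₁ m) (w j) (w (1 ℕ.+ j)) (w (2 ℕ.+ j)))
          (Within-neg (w-Within j))))
    ]′
    where
    b : ℕ → ℤ
    b i = a (n ℕ.+ i)

    w : ℕ → ℚ
    w = ℤ→ℚ ∘ b

    eq₀ : b (1 ℕ.+ p) ≡ b 0
    eq₀ = trans (periodic n ℕ.≤-refl) (cong a (sym (ℕ.+-identityʳ n)))

    eq₁ : b (2 ℕ.+ p) ≡ b 1
    eq₁ = trans (cong a (sym (ℕ.+-assoc n 1 (suc p)))) (periodic (n ℕ.+ 1) (ℕ.m≤m+n n 1))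

    w-Within : ∀ j → Within 1ℚ (combination (w j) (w (1 ℕ.+ j)) (w (2 ℕ.+ j)))
    w-Within j = recurrence⇒Within (b j) (b (1 ℕ.+ j)) (b (2 ℕ.+ j))
      (subst₂ (λ k l → IsFloor (ℤ.- a l) (r₀ * fromℤ (b j) + r₁ * fromℤ (a k)))
        (sym (ℕ.+-suc n j))
        (sym (trans (ℕ.+-suc n (suc j)) (cong suc (ℕ.+-suc n j))))
        (recurrence (n ℕ.+ j)))

  -- Fixed points for parameters in the strip.

  -- At `(1, 1)` the argument of the floor is `r₀ + r₁`, which lies in `[-1, 0)`.
  floor-at-1 : fromℤ -1ℤ ≤ r₀ + r₁ → r₀ + r₁ < fromℤ 0ℤ →
    IsFloor (ℤ.- 1ℤ) (r₀ * fromℤ 1ℤ + r₁ * fromℤ 1ℤ)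
  floor-at-1 -1≤s s<0
    = (λ x<-1 → -1≤s (≺⇒< s (fromℤ -1ℤ)
        (≺-rearrange (λ n → cong (ℚ._-_ (ℤ→ℚ -1ℤ)) (x≡s n)) (<⇒≺ x (fromℤ -1ℤ) x<-1))))
    , ≺⇒< x (fromℤ 0ℤ)
        (≺-rearrange (λ n → cong (ℚ._-_ 0ℚ) (sym (x≡s n))) (<⇒≺ s (fromℤ 0ℤ) s<0))
    where
    s = r₀ + r₁
    x = r₀ * fromℤ 1ℤ + r₁ * fromℤ 1ℤ

    x≡s : ∀ n → seq r₀ n ℚ.* 1ℚ ℚ.+ seq r₁ n ℚ.* 1ℚ ≡ seq r₀ n ℚ.+ seq r₁ n
    x≡s n = cong₂ ℚ._+_ (ℚ.*-identityʳ (seq r₀ n)) (ℚ.*-identityʳ (seq r₁ n))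

  -- At `(-1, -1)` the argument of the floor is `-(r₀ + r₁)`, which lies in `(1, 2)`.
  floor-at-minus-1 : fromℤ (ℤ.- (+ 2)) < r₀ + r₁ → r₀ + r₁ < fromℤ -1ℤ →
    IsFloor (ℤ.- -1ℤ) (r₀ * fromℤ -1ℤ + r₁ * fromℤ -1ℤ)
  floor-at-minus-1 -2<s s<-1
    -- As `x + s = 0`, adding `x < 1` and `s < -1` would give `0 < 0`.
    = (λ x<1 → ≺-irrefl {const 0ℚ} (≺-rearrange
        (λ n → solve 2 (λ p q →
            (con 1ℚ :+ con (ℤ→ℚ -1ℤ)) :- ((p :* con (ℤ→ℚ -1ℤ) :+ q :* con (ℤ→ℚ -1ℤ)) :+ (p :+ q))
              := con 0ℚ :- con 0ℚ) refl (seq r₀ n) (seq r₁ n))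
        (≺-+ (<⇒≺ x (fromℤ 1ℤ) x<1) (<⇒≺ s (fromℤ -1ℤ) s<-1))))
    , ≺⇒< x (fromℤ (+ 2)) (≺-rearrange
        (λ n → solve 2 (λ p q →
            (p :+ q) :- con (ℤ→ℚ (ℤ.- (+ 2)))
              := con (ℤ→ℚ (+ 2)) :- (p :* con (ℤ→ℚ -1ℤ) :+ q :* con (ℤ→ℚ -1ℤ))) refl
          (seq r₀ n) (seq r₁ n))
        (<⇒≺ (fromℤ (ℤ.- (+ 2))) s -2<s))
    where
    s = r₀ + r₁
    x = r₀ * fromℤ -1ℤ + r₁ * fromℤ -1ℤ

Strip⇒floor : ExcludedMiddle 0ℓ → ∀ r₀ r₁ → Strip (r₀ , r₁) →
  ∃[ a ] a ≢ 0ℤ × SameSign (a ∷ []) × IsFloor (ℤ.- a) (r₀ * fromℤ a + r₁ * fromℤ a)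
Strip⇒floor em r₀ r₁ (-2<s , s<0) with em {r₀ + r₁ < fromℤ -1ℤ}
... | yes s<-1 = -1ℤ , (λ ()) , inj₂ (ℤ.-<+ ∷ []) , floor-at-minus-1 r₀ r₁ -2<s s<-1
-- By definition of `≤`, `s≮-1` is a proof of `-1 ≤ r₀ + r₁`.
... | no  s≮-1 = 1ℤ , (λ ()) , inj₁ (ℤ.+<+ (s≤s z≤n) ∷ []) , floor-at-1 r₀ r₁ s≮-1 s<0

-- Iterates of a map.

fold-fixed : ∀ {A : Set} (f : A → A) z → f z ≡ z → ∀ n → fold z f n ≡ z
fold-fixed f z fixed zero    = refl
fold-fixed f z fixed (suc n) = trans (cong f (fold-fixed f z fixed n)) fixed

-- For an abstract f: with τ in its place, comparing a (2 + n) with its unfolding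
-- makes Agda normalise the floor.
fold-shift : ∀ {A : Set} (f : A × A → A × A) (P : A → A → A → Set) →
  (∀ a b → ∃[ c ] f (a , b) ≡ (b , c) × P a b c) →
  ∀ z (a : ℕ → A) → (∀ n → a n ≡ proj₁ (fold z f n)) →
  ∀ n → P (a n) (a (1 ℕ.+ n)) (a (2 ℕ.+ n))
fold-shift f P step z a eq n
  rewrite eq n | eq (1 ℕ.+ n) | eq (2 ℕ.+ n) with fold z f n
... | a , b with f (a , b) | step a b
...   | _ | c , refl , Pabc with f (b , c) | step b c
...     | _ | _ , refl , _ = Pabc

-- Orbits and cycles of the shift radix system.

module _ (em : ExcludedMiddle 0ℓ) where
  open ShiftRadixSystem em

  ⌊⌋-isFloor : ∀ x → IsFloor ⌊ x ⌋ x
  ⌊⌋-isFloor x = proj₂ (floor-exists em x)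

  ⌊⌋-isFloor⁻⁻ : ∀ x → IsFloor (ℤ.- (ℤ.- ⌊ x ⌋)) x
  ⌊⌋-isFloor⁻⁻ x = subst (λ k → IsFloor k x) (sym (ℤ.neg-involutive ⌊ x ⌋)) (⌊⌋-isFloor x)

  ⌊⌋-unique : ∀ k x → IsFloor k x → ⌊ x ⌋ ≡ k
  ⌊⌋-unique k x = floor-unique ⌊ x ⌋ k x (⌊⌋-isFloor x)

  floor⇒fixed : ∀ r₀ r₁ a → IsFloor (ℤ.- a) (r₀ * fromℤ a + r₁ * fromℤ a) →
    τ (r₀ , r₁) (a , a) ≡ (a , a)
  floor⇒fixed r₀ r₁ a isFloor = cong (a ,_) (trans
    (cong ℤ.-_ (⌊⌋-unique (ℤ.- a) (r₀ * fromℤ a + r₁ * fromℤ a) isFloor))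
    (ℤ.neg-involutive a))

  fixed⇒constant : ∀ r a → τ r (a , a) ≡ (a , a) → ∀ n → orbit r (a , a) n ≡ a
  fixed⇒constant r a fixed n = cong proj₁ (fold-fixed (τ r) (a , a) fixed n)

  fixed⇒periodic : ∀ r a → τ r (a , a) ≡ (a , a) →
    ∀ n → orbit r (a , a) (n ℕ.+ 1) ≡ orbit r (a , a) n
  fixed⇒periodic r a fixed n =
    trans (fixed⇒constant r a fixed (n ℕ.+ 1)) (sym (fixed⇒constant r a fixed n))

  fixed⇒cycle : ∀ r a → τ r (a , a) ≡ (a , a) → IsCycle r (a ∷ [])
  fixed⇒cycle r a fixed =
    (a , a) , 0 , 1 , s≤s z≤n , (λ n _ → fixed⇒periodic r a fixed n) , 0 , z≤n , refl

  Strip⇒fixed : ∀ r₀ r₁ → Strip (r₀ , r₁) →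
    ∃[ a ] a ≢ 0ℤ × SameSign (a ∷ []) × τ (r₀ , r₁) (a , a) ≡ (a , a)
  Strip⇒fixed r₀ r₁ strip =
    map₂ (λ {a} → map₂ (map₂ (floor⇒fixed r₀ r₁ a))) (Strip⇒floor em r₀ r₁ strip)

  τ-step : ∀ r₀ r₁ a b → ∃[ c ] τ (r₀ , r₁) (a , b) ≡ (b , c)
    × IsFloor (ℤ.- c) (r₀ * fromℤ a + r₁ * fromℤ b)
  τ-step r₀ r₁ a b = ℤ.- ⌊ r₀ * fromℤ a + r₁ * fromℤ b ⌋ , refl ,
    ⌊⌋-isFloor⁻⁻ (r₀ * fromℤ a + r₁ * fromℤ b)

  orbit-recurrence : ∀ r₀ r₁ z → Recurrence r₀ r₁ (orbit (r₀ , r₁) z)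
  orbit-recurrence r₀ r₁ z = fold-shift (τ (r₀ , r₁))
    (λ a b c → IsFloor (ℤ.- c) (r₀ * fromℤ a + r₁ * fromℤ b)) (τ-step r₀ r₁)
    z (orbit (r₀ , r₁) z) (λ _ → refl)

  sameSign-cycle⇒Strip : ∀ r₀ r₁ c → IsCycle (r₀ , r₁) c → SameSign c → Strip (r₀ , r₁)
  sameSign-cycle⇒Strip r₀ r₁ _ (z , n₀ , suc p , _ , periodic , n , n₀≤n , refl) =
    sameSign⇒Strip r₀ r₁ (orbit (r₀ , r₁) z) n p
      (λ m n≤m → periodic m (ℕ.≤-trans n₀≤n n≤m)) (orbit-recurrence r₀ r₁ z)

lemma2 : (em : ExcludedMiddle 0ℓ) →
    let open ShiftRadixSystem em in
    (∀ r₀ r₁ →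
    (∃[ c ] IsCycle (r₀ , r₁) c × Nontrivial c × SameSign c)
    ⇔ (fromℤ (ℤ.- (+ 2)) < r₀ + r₁ × r₀ + r₁ < fromℤ 0ℤ))
    × Empty (Strip ∩ 𝒟₂*)
    × (∀ r₀ r₁ →
    (fromℤ -1ℤ ≤ r₀ + r₁ → r₀ + r₁ < fromℤ 0ℤ →
    IsCycle (r₀ , r₁) (1ℤ ∷ []))
    × (fromℤ (ℤ.- (+ 2)) < r₀ + r₁ → r₀ + r₁ < fromℤ -1ℤ →
    IsCycle (r₀ , r₁) (-1ℤ ∷ [])))
lemma2 em
  = (λ r₀ r₁ → mk⇔
      (λ (c , cycle , _ , sign) → sameSign-cycle⇒Strip em r₀ r₁ c cycle sign)
      (λ strip → let (a , a≢0 , sign , fixed) = Strip⇒fixed em r₀ r₁ strip in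
        a ∷ [] , fixed⇒cycle em (r₀ , r₁) a fixed , (λ all → a≢0 (All.head all)) , sign))
  -- The orbit of the fixed point is constant, hence periodic, but its value `a` is nonzero, so it
  -- never reaches the trivial cycle.
  , (λ r@(r₀ , r₁) (strip , r∈𝒟₂*) →
      let (a , a≢0 , _ , fixed) = Strip⇒fixed em r₀ r₁ strip
          (n₀ , zero-from-n₀) = r∈𝒟₂* (a , a) (0 , 1 , s≤s z≤n , λ n _ → fixed⇒periodic em r a fixed n)
      in a≢0 (trans (sym (fixed⇒constant em r a fixed n₀)) (zero-from-n₀ n₀ ℕ.≤-refl)))
  , λ r₀ r₁ →
      (λ -1≤s s<0 → fixed⇒cycle em (r₀ , r₁) 1ℤ (floor⇒fixed em r₀ r₁ 1ℤ (floor-at-1 r₀ r₁ -1≤s s<0)))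
    , (λ -2<s s<-1 → fixed⇒cycle em (r₀ , r₁) -1ℤ (floor⇒fixed em r₀ r₁ -1ℤ (floor-at-minus-1 r₀ r₁ -2<s s<-1)))
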